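{- (1) If $P:\mathbb N\to\mathsf{Prop}$ is a family of decidable propositions (each $P_n\lor\neg P_n$), then $\forall n.\,P_n$ is $\omega^2$-decidable. (2) If $Q$ is a semidecidable proposition, then $\neg Q$ is $\omega^2$-decidable.
   Context: We work in homotopy type theory with propositional truncation. A proposition $Q$ is semidecidable if $\exists (s:\mathbb N\to\mathbf 2).\,(Q\leftrightarrow\exists i.\,s_i=1)$. $\mathsf{Brw}$ is the type of Brouwer ordinals, defined as a set-truncated quotient inductive-inductive type simultaneously with a proposition-valued relation $\le$: point constructors $\mathsf{zero}$, $\mathsf{succ}$, and $\mathsf{lim}$ of strictly increasing sequences $f:\mathbb N\to\mathsf{Brw}$ ($\forall n.\,\mathsf{succ}(f_n)\le f_{n+1}$); a path constructor identifying limits of mutually simulating sequences; $\le$ is transitive, proposition-valued, with $\mathsf{zero}$ minimal, $\mathsf{succ}$ monotone, $\mathsf{lim}\,f$ the least upper bound of $f$. $\omega=\mathsf{lim}(\lambda n.\,n)$ and $\omega^2=\mathsf{lim}(\lambda k.\,\omega\cdot k)$. A proposition $P$ is $\alpha$-decidable if $\exists y:\mathsf{Brw}.\,(P\leftrightarrow \alpha\le y)$. -}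

module Defs where

open import Data.Nat using (ℕ; zero; suc)
open import Data.Bool using (Bool; true; false)
open import Data.Product using (Σ; _×_; _,_)
open import Relation.Binary.PropositionalEquality using (_≡_)

data Brw : Set
data _≤_ : Brw → Brw → Set

Increasing : (ℕ → Brw) → Set

data Brw where
  zero : Brw
  succ : Brw → Brw
  lim  : (f : ℕ → Brw) → Increasing f → Brw

data _≤_ where
  ≤-zero     : ∀ {x} → zero ≤ x
  ≤-trans    : ∀ {x y z} → x ≤ y → y ≤ z → x ≤ z
  ≤-succ-mono : ∀ {x y} → x ≤ y → succ x ≤ succ y
  ≤-cocone   : ∀ {f} {p : Increasing f} {x} (k : ℕ) → x ≤ f k → x ≤ lim f p
  ≤-limiting : ∀ {f} {p : Increasing f} {x} → ((k : ℕ) → f k ≤ x) → lim f p ≤ x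

Increasing f = (n : ℕ) → succ (f n) ≤ f (suc n)

≤-refl : (x : Brw) → x ≤ x
≤-refl zero = ≤-zero
≤-refl (succ x) = ≤-succ-mono (≤-refl x)
≤-refl (lim f p) = ≤-limiting (λ k → ≤-cocone k (≤-refl (f k)))

_+ℕ_ : Brw → ℕ → Brw
x +ℕ zero = x
x +ℕ suc n = succ (x +ℕ n)

+ℕ-increasing : (x : Brw) → Increasing (λ n → x +ℕ n)
+ℕ-increasing x n = ≤-refl (succ (x +ℕ n))

ι : ℕ → Brw
ι n = zero +ℕ n

ω : Brw
ω = lim ι (+ℕ-increasing zero)

-- ω · k, with ω · 0 = zero and ω · (k+1) = ω · k + ω = lim (λ n → ω · k + n)
ω·_ : ℕ → Brw
ω· zero = zero
ω· suc k = lim (λ n → (ω· k) +ℕ n) (+ℕ-increasing (ω· k))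

ω·-increasing : Increasing ω·_
ω·-increasing k = ≤-cocone 1 (≤-refl (succ (ω· k)))

ω² : Brw
ω² = lim ω·_ ω·-increasing

isProp : Set → Set
isProp A = (a b : A) → a ≡ b

Semidecidable : Set → Set
Semidecidable Q = Σ (ℕ → Bool) λ s → (Q → Σ ℕ λ i → s i ≡ true) × ((Σ ℕ λ i → s i ≡ true) → Q)

_-decidable_ : Brw → Set → Set
α -decidable P = Σ Brw λ y → (P → α ≤ y) × (α ≤ y → P)

{-# OPTIONS --safe #-}
-- A sequence b : ℕ → Bool is turned into the limit of the sequence that climbs
-- ω·0, ω·1, ω·2, … while b stays true and, once b first fails at j, continues
-- ω·j + 1, ω·j + 2, …; the limit is ω² if b never fails and at most ω·(j+1)
-- otherwise.  Refuting ω² ≤ ω·(j+1) needs an invariant of the inductively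
-- generated order: (i , n) ≼ x, read as ω·i + n ≤ x, is defined by recursion
-- on x and is preserved by ≤.
module Submission where

open import Defs
open import Data.Nat as ℕ using (ℕ; zero; suc; _+_; _<_; _≤′_; ≤′-refl; ≤′-step)
open import Data.Nat.Properties using (≤⇒≤′; m+n≤o⇒m≤o; n<1+n; +-suc; +-identityʳ)
open import Data.Product using (_×_; ∃-syntax; _,_)
open import Relation.Nullary using (Dec; ¬_)
open import Data.Bool using (Bool; true; false; not; T; if_then_else_)
open import Data.Unit using (⊤; tt)
open import Data.Empty using (⊥)
open import Function using (_∘_; _⇔_; mk⇔; Equivalence)
open import Relation.Nullary.Decidable using (⌊_⌋; toWitness; fromWitness)
open import Relation.Binary.PropositionalEquality using (_≡_; subst; sym; trans; cong)

_≼_ : ℕ × ℕ → Brw → Set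
(i     , suc n) ≼ zero    = ⊥
(i     , suc n) ≼ succ x  = (i , n) ≼ x
(i     , suc n) ≼ lim f _ = ∃[ k ] (i , suc n) ≼ f k
(zero  , zero)  ≼ x       = ⊤
(suc i , zero)  ≼ zero    = ⊥
(suc i , zero)  ≼ succ x  = (suc i , zero) ≼ x
(suc i , zero)  ≼ lim f _ = ∀ m → ∃[ k ] (i , m) ≼ f k

≼-pred : ∀ x i n → (i , suc n) ≼ x → (i , n) ≼ x
≼-limit⇒≼ : ∀ x i n → (suc i , zero) ≼ x → (i , n) ≼ x

≼-pred (succ x)  zero    zero    _       = tt
≼-pred (succ x)  (suc i) zero    h       = h
≼-pred (succ x)  i       (suc n) h       = ≼-pred x i n h
≼-pred (lim f _) zero    zero    _       = tt
≼-pred (lim f _) (suc i) zero    (k , h) = λ m → k , ≼-limit⇒≼ (f k) i m (≼-pred (f k) (suc i) zero h)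
≼-pred (lim f _) i       (suc n) (k , h) = k , ≼-pred (f k) i (suc n) h

≼-limit⇒≼ (succ x)  zero    zero    _ = tt
≼-limit⇒≼ (succ x)  (suc i) zero    h = ≼-limit⇒≼ x (suc i) zero h
≼-limit⇒≼ (succ x)  i       (suc n) h = ≼-limit⇒≼ x i n h
≼-limit⇒≼ (lim f _) zero    zero    _ = tt
≼-limit⇒≼ (lim f _) (suc i) zero    h = λ m → let (k , hₖ) = h zero in k , ≼-limit⇒≼ (f k) i m hₖ
≼-limit⇒≼ (lim f _) i       (suc n) h = h (suc n)

≼-limit : ∀ x i → (∀ m → (i , m) ≼ x) → (suc i , zero) ≼ x
≼-limit zero      i h = h 1
≼-limit (succ x)  i h = ≼-limit x i (h ∘ suc)
≼-limit (lim f _) i h m = let (k , hₖ) = h (suc m) in k , ≼-pred (f k) i m hₖ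

≼-cocone : ∀ {f p} a k → a ≼ f k → a ≼ lim f p
≼-cocone     (zero  , zero)  k h   = tt
≼-cocone {f} (suc i , zero)  k h m = k , ≼-limit⇒≼ (f k) i m h
≼-cocone     (i     , suc n) k h   = k , h

≼-mono : ∀ {x y} → x ≤ y → ∀ a → a ≼ x → a ≼ y
≼-mono _                 (zero  , zero)  _       = tt
≼-mono ≤-zero            (suc i , zero)  ()
≼-mono ≤-zero            (i     , suc n) ()
≼-mono (≤-trans x≤y y≤z) a               h       = ≼-mono y≤z a (≼-mono x≤y a h)
≼-mono (≤-succ-mono x≤y) (suc i , zero)  h       = ≼-mono x≤y (suc i , zero) h
≼-mono (≤-succ-mono x≤y) (i     , suc n) h       = ≼-mono x≤y (i , n) h
≼-mono (≤-cocone k x≤fₖ) a               h       = ≼-cocone a k (≼-mono x≤fₖ a h)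
≼-mono {y = y} (≤-limiting f≤y) (suc i , zero) h =
  ≼-limit y i (λ m → let (k , hₖ) = h m in ≼-mono (f≤y k) (i , m) hₖ)
≼-mono (≤-limiting f≤y)  (i     , suc n) (k , h) = ≼-mono (f≤y k) (i , suc n) h

≼-+ℕ : ∀ x {i} n → (i , zero) ≼ x → (i , n) ≼ (x +ℕ n)
≼-+ℕ x zero    h = h
≼-+ℕ x (suc n) h = ≼-+ℕ x n h

≼-ω· : ∀ i → (i , zero) ≼ (ω· i)
≼-ω· zero    = tt
≼-ω· (suc i) m = m , ≼-+ℕ (ω· i) m (≼-ω· i)

≼-ω² : ∀ i → (i , zero) ≼ ω²
≼-ω² i = ≼-mono (≤-cocone i (≤-refl (ω· i))) (i , zero) (≼-ω· i)

≼-limit-+ℕ : ∀ x {i} n → (suc i , zero) ≼ (x +ℕ n) → (suc i , zero) ≼ x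
≼-limit-+ℕ x zero    h = h
≼-limit-+ℕ x (suc n) h = ≼-limit-+ℕ x n h

⋠-ω· : ∀ i → ¬ (suc i , zero) ≼ (ω· i)
⋠-ω· zero    ()
⋠-ω· (suc i) h with h zero
... | k , hₖ = ⋠-ω· i (≼-limit-+ℕ (ω· i) k hₖ)

ω²≰ω· : ∀ i → ¬ ω² ≤ (ω· i)
ω²≰ω· i ω²≤ω·i = ⋠-ω· i (≼-mono ω²≤ω·i (suc i , zero) (≼-ω² (suc i)))

ω·-mono : ∀ {i j} → i ℕ.≤ j → (ω· i) ≤ (ω· j)
ω·-mono = go ∘ ≤⇒≤′
  where
  go : ∀ {i j} → i ≤′ j → (ω· i) ≤ (ω· j)
  go ≤′-refl      = ≤-refl _
  go (≤′-step i≤j) = ≤-trans (go i≤j) (≤-cocone 0 (≤-refl _))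

climb : (ℕ → Bool) → ℕ → ℕ → Brw
climb b j zero    = ω· j
climb b j (suc k) = if b 0 then climb (b ∘ suc) (suc j) k else (ω· j) +ℕ suc k

climb-increasing : ∀ b j → Increasing (climb b j)
climb-increasing b j zero with b 0
... | true  = ω·-increasing j
... | false = ≤-refl _
climb-increasing b j (suc k) with b 0
... | true  = climb-increasing (b ∘ suc) (suc j) k
... | false = ≤-refl _

climb-all-true : ∀ b j k → (∀ n → T (b n)) → climb b j k ≡ ω· (j + k)
climb-all-true b j zero    _ = cong ω·_ (sym (+-identityʳ j))
climb-all-true b j (suc k) h with b 0 | h 0
... | true  | _  = trans (climb-all-true (b ∘ suc) (suc j) k (h ∘ suc)) (cong ω·_ (sym (+-suc j k)))
... | false | ()

ω·+ℕ≤ω· : ∀ {j i} m → j < i → ((ω· j) +ℕ m) ≤ (ω· i)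
ω·+ℕ≤ω· m j<i = ≤-trans (≤-cocone m (≤-refl _)) (ω·-mono j<i)

climb-bounded : ∀ b j n → b n ≡ false → ∀ {i} → j + n < i → ∀ k → climb b j k ≤ (ω· i)
climb-bounded b j n       _  j+n<i zero = ω·+ℕ≤ω· 0 (m+n≤o⇒m≤o (suc j) j+n<i)
climb-bounded b j zero    bₙ j+n<i (suc k) rewrite bₙ = ω·+ℕ≤ω· (suc k) (m+n≤o⇒m≤o (suc j) j+n<i)
climb-bounded b j (suc n) bₙ {i} j+n<i (suc k) with b 0
... | true  = climb-bounded (b ∘ suc) (suc j) n bₙ (subst (_< i) (+-suc j n) j+n<i) k
... | false = ω·+ℕ≤ω· (suc k) (m+n≤o⇒m≤o (suc j) j+n<i)

all-true-ω²-decidable : (b : ℕ → Bool) → ω² -decidable (∀ n → T (b n))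
all-true-ω²-decidable b = lim (climb b 0) (climb-increasing b 0) , reaches , bounded
  where
  reaches : (∀ n → T (b n)) → ω² ≤ lim (climb b 0) (climb-increasing b 0)
  reaches h = ≤-limiting λ k →
    ≤-cocone k (subst ((ω· k) ≤_) (sym (climb-all-true b 0 k h)) (≤-refl (ω· k)))
  bounded : ω² ≤ lim (climb b 0) (climb-increasing b 0) → ∀ n → T (b n)
  bounded ω²≤ n with b n in bₙ
  ... | true  = tt
  ... | false = ω²≰ω· (suc n) (≤-trans ω²≤ (≤-limiting (climb-bounded b 0 n bₙ (n<1+n n))))

α-decidable-resp-⇔ : ∀ {α P Q} → P ⇔ Q → α -decidable P → α -decidable Q
α-decidable-resp-⇔ P⇔Q (y , P→α≤y , α≤y→P) =
  y , P→α≤y ∘ Equivalence.from P⇔Q , Equivalence.to P⇔Q ∘ α≤y→P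

all-decided⇔all : ∀ {P : ℕ → Set} (P? : ∀ n → Dec (P n)) → (∀ n → T ⌊ P? n ⌋) ⇔ (∀ n → P n)
all-decided⇔all P? = mk⇔ (λ h n → toWitness (h n)) (λ h n → fromWitness (h n))

never-true⇔¬ : ∀ {Q : Set} (s : ℕ → Bool) → (Q → ∃[ i ] s i ≡ true) → (∃[ i ] s i ≡ true → Q)
             → (∀ n → T (not (s n))) ⇔ (¬ Q)
never-true⇔¬ {Q} s Q→s s→Q = mk⇔ to from
  where
  to : (∀ n → T (not (s n))) → ¬ Q
  to h q = let (i , sᵢ) = Q→s q in subst (T ∘ not) sᵢ (h i)
  from : ¬ Q → ∀ n → T (not (s n))
  from ¬Q n with s n in sₙ
  ... | true  = ¬Q (s→Q (n , sₙ))
  ... | false = tt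

corollary7p9 : ((P : ℕ → Set) → ((n : ℕ) → isProp (P n)) → ((n : ℕ) → Dec (P n))
                  → ω² -decidable ((n : ℕ) → P n))
             × ((Q : Set) → isProp Q → Semidecidable Q → ω² -decidable (¬ Q))
corollary7p9 =
  (λ P _ P? → α-decidable-resp-⇔ (all-decided⇔all P?)
                (all-true-ω²-decidable (λ n → ⌊ P? n ⌋))) ,
  (λ Q _ (s , Q→s , s→Q) → α-decidable-resp-⇔ (never-true⇔¬ s Q→s s→Q)
                             (all-true-ω²-decidable (not ∘ s)))
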